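{- Let $G$ be a fixed edge-ordered graph, let $ab$ be the minimal edge of $G$, and assume that $\deg(a)\ge 2$. If $N_G(a)\cap N_G(b)=\emptyset$, then $ssat_m(n,G)=\Theta(n)$.
   Context: An edge-ordered graph is a finite simple graph together with a linear order on its edge set (usually given by an injective labeling $l:E\to\mathbb{N}$ or $l:E\to\mathbb{R}$). A copy of $G$ in an edge-ordered graph $H$ is a subgraph of $H$ (with the induced edge-order) isomorphic to $G$ by an isomorphism respecting the edge-order. The minimal edge is the edge with the smallest label. $N_G(a)$ denotes the open neighborhood of $a$ in $G$. $ssat_m(n,G)$ is the minimum number of edges in an edge-ordered graph $H$ on $n$ vertices (not required to be $G$-free) such that adding to $H$ any missing edge, inserted at the beginning of the linear order (i.e. with a label smaller than all labels of $H$), creates a new copy of $G$ (one using the added edge). Asymptotic notation is for $n\to\infty$ with $G$ fixed. -}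

module Defs where

open import Data.Nat using (ℕ; zero; suc; _+_; _*_; _≤_; _<_; s≤s)
import Data.Nat.Properties as ℕₚ
open import Data.Fin as Fin using (Fin; finToFun; funToFin; combine; remQuot)
import Data.Fin.Properties as Finₚ
open import Data.Fin.Subset using (Subset; ∣_∣)
open import Data.List using (List; []; _∷_; length; head; map; filter; lookup; tabulate; cartesianProduct; allFin)
open import Data.List.Properties using (map-cong; tabulate-cong; tabulate-lookup; length-tabulate)
open import Data.List.Relation.Unary.All using (All; []; _∷_; all?)
import Data.List.Relation.Unary.All as All
import Data.List.Relation.Unary.All.Properties as Allₚ
open import Data.List.Relation.Unary.AllPairs using (AllPairs; []; _∷_; allPairs?)
import Data.List.Relation.Unary.AllPairs as AllPairs
import Data.List.Relation.Unary.AllPairs.Properties as AllPairsₚ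
open import Data.List.Relation.Unary.Any using (Any; any?)
import Data.List.Relation.Unary.Any as Any
open import Data.List.Relation.Unary.Unique.Propositional using (Unique)
import Data.List.Relation.Unary.Unique.Propositional.Properties as Uniqueₚ
open import Data.List.Membership.Propositional using (_∈_)
import Data.List.Membership.Propositional.Properties as ∈ₚ
open import Data.List.Relation.Binary.Sublist.Heterogeneous using (Sublist)
open import Data.List.Relation.Binary.Sublist.Heterogeneous.Properties using (sublist?)
import Data.Maybe.Relation.Unary.Any as Maybe
import Data.Vec as Vec
open import Data.Product as Product using (Σ; ∃; ∃-syntax; _×_; _,_; proj₁; proj₂)
open import Data.Sum using (_⊎_; inj₁; inj₂)
open import Data.Empty using (⊥-elim)
open import Function.Definitions using (Injective)
open import Relation.Nullary using (¬_; Dec; yes; no; does; ¬?)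
open import Relation.Nullary.Decidable using (map′; _×-dec_; _⊎-dec_; _→-dec_)
open import Relation.Unary using (Pred; Decidable)
open import Relation.Binary.Definitions using (tri<; tri≈; tri>)
open import Relation.Binary.PropositionalEquality
  using (_≡_; _≢_; refl; sym; trans; cong; cong₂; subst)

------------------------------------------------------------------------
-- Edge-ordered graphs

-- An edge is written as a pair of vertices; the two ways of writing it
-- are identified by _≈ₑ_.
Edge : ℕ → Set
Edge n = Fin n × Fin n

infix 4 _≈ₑ_
_≈ₑ_ : ∀ {n} → Edge n → Edge n → Set
(u , v) ≈ₑ (x , y) = (u ≡ x × v ≡ y) ⊎ (u ≡ y × v ≡ x)

-- A finite simple graph on the vertex set Fin n with a linear order on
-- its edge set. The order is given by listing every edge exactly once, in
-- increasing order (so the label of an edge is its position in the list).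
record EOGraph (n : ℕ) : Set where
  field
    edges    : List (Edge n)
    loopless : All (λ (u , v) → u ≢ v) edges
    simple   : AllPairs (λ e f → ¬ (e ≈ₑ f)) edges

open EOGraph public

size : ∀ {n} → EOGraph n → ℕ
size H = length (edges H)

Adj : ∀ {n} → EOGraph n → Fin n → Fin n → Set
Adj H u v = Any ((u , v) ≈ₑ_) (edges H)

_≈ₑ?_ : ∀ {n} (e f : Edge n) → Dec (e ≈ₑ f)
(u , v) ≈ₑ? (x , y) =
  (u Fin.≟ x ×-dec v Fin.≟ y) ⊎-dec (u Fin.≟ y ×-dec v Fin.≟ x)

adj? : ∀ {n} (H : EOGraph n) u v → Dec (Adj H u v)
adj? H u v = any? ((u , v) ≈ₑ?_) (edges H)

N : ∀ {n} → EOGraph n → Fin n → Subset n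
N H u = Vec.tabulate (λ v → does (adj? H u v))

deg : ∀ {n} → EOGraph n → Fin n → ℕ
deg H u = ∣ N H u ∣

-- The graph has an edge, and its first one joins a and b.
IsMinimalEdge : ∀ {n} → EOGraph n → Fin n → Fin n → Set
IsMinimalEdge G a b = Maybe.Any ((a , b) ≈ₑ_) (head (edges G))

------------------------------------------------------------------------
-- Copies and saturation

mapEdge : ∀ {k n} → (Fin k → Fin n) → Edge k → Edge n
mapEdge f = Product.map f f

-- A (not necessarily induced) subgraph with the induced edge-order is a
-- sublist of the edges of H. So "orderly" says that f carries the edges of
-- G, in their order, to those of a subgraph of H, in the order of H.
record Copy {k n} (G : EOGraph k) (H : EOGraph n) : Set where
  field
    embed     : Fin k → Fin n
    injective : Injective _≡_ _≡_ embed
    orderly   : Sublist _≈ₑ_ (map (mapEdge embed) (edges G)) (edges H)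

open Copy public

Uses : ∀ {k n} {G : EOGraph k} {H : EOGraph n} → Copy G H → Edge n → Set
Uses {G = G} c e = Any (e ≈ₑ_) (map (mapEdge (embed c)) (edges G))

-- H together with the missing edge uv, placed before all edges of H.
addMin : ∀ {n} (H : EOGraph n) (u v : Fin n) → u ≢ v → ¬ Adj H u v → EOGraph n
addMin H u v u≢v u≁v = record
  { edges    = (u , v) ∷ edges H
  ; loopless = u≢v ∷ loopless H
  ; simple   = Allₚ.¬Any⇒All¬ _ u≁v ∷ simple H
  }

Saturated : ∀ {k n} → EOGraph k → EOGraph n → Set
Saturated G H = ∀ u v (u≢v : u ≢ v) (u≁v : ¬ Adj H u v) →
  Σ (Copy G (addMin H u v u≢v u≁v)) λ c → Uses c (u , v)

HasSaturated : ∀ {k} → ℕ → EOGraph k → ℕ → Set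
HasSaturated n G m = ∃[ H ] Saturated {n = n} G H × size H ≡ m

IsLeast : (ℕ → Set) → ℕ → Set
IsLeast P m = P m × (∀ j → P j → m ≤ j)

------------------------------------------------------------------------
-- Asymptotics

-- The lower bound is g n ≤ c * f n, i.e. (1/c) g n ≤ f n; natural constants
-- suffice, since only their size from above matters. Allowing c or C to be 0
-- adds nothing: then the same inequalities hold with 1 in its place.
infix 4 _=Θ_
_=Θ_ : (ℕ → ℕ) → (ℕ → ℕ) → Set
f =Θ g = ∃[ c ] ∃[ C ] ∃[ n₀ ] (∀ n → n₀ ≤ n → g n ≤ c * f n × f n ≤ C * g n)

------------------------------------------------------------------------
-- Existence of the minimum defining ssat

private
  least : {P : ℕ → Set} → Decidable P → ∃ P → ∃ (IsLeast P)
  least {P} P? (m , pm) = go m 0 pm′ (λ _ ())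
    where
    pm′ : P (m + 0)
    pm′ = subst P (sym (ℕₚ.+-identityʳ m)) pm
    go : ∀ d i → P (d + i) → (∀ j → j < i → ¬ P j) → ∃ (IsLeast P)
    go d i pd below with P? i
    ... | yes pi = i , pi , λ j pj → ℕₚ.≮⇒≥ (λ j<i → below j j<i pj)
    go zero    i pd below | no ¬pi = ⊥-elim (¬pi pd)
    go (suc d) i pd below | no ¬pi =
      go d (suc i) (subst P (sym (ℕₚ.+-suc d i)) pd) below′
      where
      below′ : ∀ j → j < suc i → ¬ P j
      below′ j (s≤s j≤i) pj with ℕₚ.m≤n⇒m<n∨m≡n j≤i
      ... | inj₁ j<i  = below j j<i pj
      ... | inj₂ refl = ¬pi pj

  any-function? : ∀ {m n} {P : (Fin m → Fin n) → Set} →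
    (∀ {f g} → (∀ i → f i ≡ g i) → P f → P g) →
    (∀ f → Dec (P f)) → Dec (∃ P)
  any-function? resp P? =
    map′ (λ (i , p) → finToFun i , p)
         (λ (f , p) → funToFin f , resp (λ i → sym (Finₚ.finToFun-funToFin f i)) p)
         (Finₚ.any? (λ i → P? (finToFun i)))

  injective? : ∀ {k n} (f : Fin k → Fin n) → Dec (Injective _≡_ _≡_ f)
  injective? f =
    map′ (λ h {x} {y} → h x y) (λ h x y → h {x} {y})
         (Finₚ.all? λ x → Finₚ.all? λ y → (f x Fin.≟ f y) →-dec (x Fin.≟ y))

  mapEdge-cong : ∀ {k n} {f g : Fin k → Fin n} → (∀ i → f i ≡ g i) →
    (es : List (Edge k)) → map (mapEdge f) es ≡ map (mapEdge g) es
  mapEdge-cong f≗g = map-cong λ (u , v) → cong₂ _,_ (f≗g u) (f≗g v)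

  copy-using? : ∀ {k n} (G : EOGraph k) (H : EOGraph n) e →
    Dec (Σ (Copy G H) λ c → Uses c e)
  copy-using? G H e =
    map′ (λ (f , inj , ord , use) →
            record { embed = f ; injective = λ {x} {y} → inj {x} {y} ; orderly = ord } , use)
         (λ (c , use) → embed c , (λ {x} {y} → injective c {x} {y}) , orderly c , use)
         (any-function?
           (λ {f} {g} f≗g (inj , ord , use) →
             (λ {x} {y} eq → inj (trans (f≗g x) (trans eq (sym (f≗g y))))) ,
             subst (λ es → Sublist _≈ₑ_ es (edges H)) (mapEdge-cong f≗g (edges G)) ord ,
             subst (Any (e ≈ₑ_)) (mapEdge-cong f≗g (edges G)) use)
           (λ f → injective? f
             ×-dec sublist? _≈ₑ?_ (map (mapEdge f) (edges G)) (edges H)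
             ×-dec any? (e ≈ₑ?_) (map (mapEdge f) (edges G))))

  copy-resp : ∀ {k n} {G : EOGraph k} {H H′ : EOGraph n} {e} → edges H ≡ edges H′ →
    Σ (Copy G H) (λ c → Uses c e) → Σ (Copy G H′) (λ c → Uses c e)
  copy-resp {G = G} eq (c , use) = record
    { embed     = embed c
    ; injective = injective c
    ; orderly   = subst (Sublist _≈ₑ_ (map (mapEdge (embed c)) (edges G))) eq (orderly c)
    } , use

  saturated-resp : ∀ {k n} {G : EOGraph k} {H H′ : EOGraph n} → edges H ≡ edges H′ →
    Saturated G H → Saturated G H′
  saturated-resp {H = H} {H′} eq sat u v u≢v u≁v =
    copy-resp {H = addMin H u v u≢v u≁v′} {addMin H′ u v u≢v u≁v} (cong ((u , v) ∷_) eq)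
              (sat u v u≢v u≁v′)
    where
    u≁v′ : ¬ Adj H u v
    u≁v′ uv = u≁v (subst (Any ((u , v) ≈ₑ_)) eq uv)

  saturated? : ∀ {k n} (G : EOGraph k) (H : EOGraph n) → Dec (Saturated G H)
  saturated? G H = Finₚ.all? λ u → Finₚ.all? λ v → at u v
    where
    at : ∀ u v → Dec ((u≢v : u ≢ v) (u≁v : ¬ Adj H u v) →
                      Σ (Copy G (addMin H u v u≢v u≁v)) λ c → Uses c (u , v))
    at u v with u Fin.≟ v | adj? H u v
    ... | yes u≡v | _      = yes (λ u≢v _ → ⊥-elim (u≢v u≡v))
    ... | no _    | yes uv = yes (λ _ u≁v → ⊥-elim (u≁v uv))
    ... | no u≢v  | no u≁v = map′ (λ c _ _ → copy-resp refl c) (λ h → h u≢v u≁v)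
                                  (copy-using? G (addMin H u v u≢v u≁v) (u , v))

  hasSaturated? : ∀ {k} n (G : EOGraph k) → Decidable (HasSaturated n G)
  hasSaturated? n G m =
    map′ to from (any-function? {n = n * n} resp dec)
    where
    listed : (Fin m → Fin (n * n)) → List (Edge n)
    listed f = tabulate (λ i → remQuot n (f i))

    Good : List (Edge n) → Set
    Good es = ∃[ H ] edges H ≡ es × Saturated G H

    good? : ∀ es → Dec (Good es)
    good? es with all? (λ (u , v) → ¬? (u Fin.≟ v)) es
                | allPairs? (λ e f → ¬? (e ≈ₑ? f)) es
    ... | no ¬l | _     = no λ (H , eq , _) → ¬l (subst (All _) eq (loopless H))
    ... | yes _ | no ¬s = no λ (H , eq , _) → ¬s (subst (AllPairs _) eq (simple H))
    ... | yes l | yes s = map′ (λ sat → H′ , refl , sat)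
                               (λ (H , eq , sat) → saturated-resp eq sat)
                               (saturated? G H′)
      where
      H′ : EOGraph n
      H′ = record { edges = es ; loopless = l ; simple = s }

    resp : ∀ {f g} → (∀ i → f i ≡ g i) → Good (listed f) → Good (listed g)
    resp f≗g = subst Good (tabulate-cong (λ i → cong (remQuot n) (f≗g i)))

    dec : ∀ f → Dec (Good (listed f))
    dec f = good? (listed f)

    to : ∃ (λ f → Good (listed f)) → HasSaturated n G m
    to (f , H , eq , sat) = H , sat , trans (cong length eq) (length-tabulate _)

    from : HasSaturated n G m → ∃ (λ f → Good (listed f))
    from (H , sat , refl) =
      (λ i → Product.uncurry combine (lookup (edges H) i)) , H ,
      sym (trans (tabulate-cong (λ i → Finₚ.remQuot-combine _ _))
                 (tabulate-lookup (edges H))) ,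
      sat

  complete : ∀ n → EOGraph n
  complete n = record
    { edges    = filter increasing? pairs
    ; loopless = All.map
                   (λ u<v u≡v → Finₚ.<⇒≢ u<v u≡v) (Allₚ.all-filter increasing? pairs)
    ; simple   = distinct (Allₚ.all-filter increasing? pairs)
                          (Uniqueₚ.filter⁺ increasing? unique)
    }
    where
    pairs : List (Edge n)
    pairs = cartesianProduct (allFin n) (allFin n)

    increasing? : Decidable (λ ((u , v) : Edge n) → u Fin.< v)
    increasing? (u , v) = u Fin.<? v

    unique : Unique pairs
    unique = Uniqueₚ.cartesianProduct⁺ (Uniqueₚ.allFin⁺ n) (Uniqueₚ.allFin⁺ n)

    apart : ∀ {e f : Edge n} → proj₁ e Fin.< proj₂ e → proj₁ f Fin.< proj₂ f →
            e ≢ f → ¬ (e ≈ₑ f)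
    apart e< f< e≢f (inj₁ (refl , refl)) = e≢f refl
    apart e< f< e≢f (inj₂ (refl , refl)) = ℕₚ.<-asym e< f<

    distinct : ∀ {es} → All (λ (u , v) → u Fin.< v) es → Unique es →
               AllPairs (λ e f → ¬ (e ≈ₑ f)) es
    distinct []       []       = []
    distinct (e< ∷ <s) (e≢ ∷ ≢s) =
      All.zipWith (λ (f< , e≢f) → apart e< f< e≢f) (<s , e≢)
      ∷ distinct <s ≢s

  complete-adj : ∀ n {u v} → u ≢ v → Adj (complete n) u v
  complete-adj n {u} {v} u≢v with Finₚ.<-cmp u v
  ... | tri< u<v _ _ = Any.map (λ { refl → inj₁ (refl , refl) })
    (∈ₚ.∈-filter⁺ _ (∈ₚ.∈-cartesianProduct⁺ (∈ₚ.∈-allFin u) (∈ₚ.∈-allFin v)) u<v)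
  ... | tri≈ _ u≡v _ = ⊥-elim (u≢v u≡v)
  ... | tri> _ _ v<u = Any.map (λ { refl → inj₂ (refl , refl) })
    (∈ₚ.∈-filter⁺ _ (∈ₚ.∈-cartesianProduct⁺ (∈ₚ.∈-allFin v) (∈ₚ.∈-allFin u)) v<u)

  hasSaturated : ∀ {k} n (G : EOGraph k) → ∃ (HasSaturated n G)
  hasSaturated n G = size (complete n) , complete n ,
    (λ u v u≢v u≁v → ⊥-elim (u≁v (complete-adj n u≢v))) , refl

ssatₘ-minimum : ∀ {k} n (G : EOGraph k) → ∃ (IsLeast (HasSaturated n G))
ssatₘ-minimum n G = least (hasSaturated? n G) (hasSaturated n G)

ssatₘ : ∀ {k} → ℕ → EOGraph k → ℕ
ssatₘ n G = proj₁ (ssatₘ-minimum n G)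

ssatₘ-isLeast : ∀ {k} n (G : EOGraph k) → IsLeast (HasSaturated n G) (ssatₘ n G)
ssatₘ-isLeast n G = proj₂ (ssatₘ-minimum n G)

-- Lower bound: in the copy created by a new minimal edge uv, that edge plays
-- ab, and a has a second edge, which lies in H; so u or v is not isolated in
-- H. Hence H has at most one isolated vertex and at least (n - 1)/2 edges.
--
-- Upper bound: take a core of k vertices and join each core vertex to every
-- vertex. An edge from the core vertex of x to a vertex outside the core gets
-- the rank of ax or bx in G, which is unambiguous because a and b have no
-- common neighbour. A missing edge uv lies outside the core, and the core
-- completes it to a copy of G with u and v in the places of a and b.

module Submission where

open import Defs
open import Data.Nat using (ℕ; zero; suc; _+_; _*_; _≤_; _<_; s≤s; z≤n)
import Data.Nat.Properties as ℕₚ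
open import Data.Fin as Fin using (Fin; toℕ; inject≤; fromℕ<)
import Data.Fin.Properties as Finₚ
open import Data.Fin.Subset using (Empty; _∩_; ⁅_⁆) renaming (_∈_ to _∈ₛ_)
open import Data.Fin.Subset.Properties using (p⊆q⇒∣p∣≤∣q∣; ∣⁅x⁆∣≡1; x∈⁅x⁆; x∈p∩q⁺)
open import Data.List using (List; []; _∷_; _++_; length; lookup; map; filter; concatMap; cartesianProduct; allFin)
open import Data.List.Properties using (length-++; length-map; length-tabulate; length-filter)
import Data.List.Relation.Binary.Sublist.Heterogeneous.Properties as Sublistₚ
open import Data.List.Relation.Binary.Sublist.Heterogeneous using (Sublist; []; _∷_; _∷ʳ_; fromAny)
open import Data.List.Relation.Unary.All using (All; []; _∷_)
import Data.List.Relation.Unary.All as All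
import Data.List.Relation.Unary.All.Properties as Allₚ
open import Data.List.Relation.Unary.AllPairs using (AllPairs; []; _∷_)
import Data.List.Relation.Unary.AllPairs.Properties as AllPairsₚ
open import Data.List.Relation.Unary.Any using (Any; here; there; any?)
import Data.List.Relation.Unary.Any as Any
import Data.List.Relation.Unary.Any.Properties as Anyₚ
open import Data.List.Relation.Unary.Unique.Propositional using (Unique)
import Data.List.Relation.Unary.Unique.Propositional.Properties as Uniqueₚ
open import Data.List.Membership.Propositional using (_∈_; lose)
import Data.List.Membership.Propositional.Properties as ∈ₚ
open import Data.Maybe.Relation.Unary.Any using (just)
import Data.Vec.Properties as Vecₚ
open import Data.Product using (∃; _×_; _,_; proj₁; proj₂)
open import Data.Sum using (_⊎_; inj₁; inj₂)
import Data.Sum as Sum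
open import Function using (_∘_)
open import Relation.Nullary using (¬_; Dec; yes; no; ¬?; contradiction)
open import Relation.Nullary.Decidable using (_×-dec_; _⊎-dec_; dec-true; decidable-stable)
open import Relation.Unary using (Decidable)
open import Relation.Binary.Definitions using (tri<; tri≈; tri>)
open import Relation.Binary.PropositionalEquality
  using (_≡_; _≢_; refl; sym; trans; cong; cong₂; subst)

-- Edges up to reversal, and neighbourhoods.

≈ₑ-refl : ∀ {n} {e : Edge n} → e ≈ₑ e
≈ₑ-refl = inj₁ (refl , refl)

≈ₑ-sym : ∀ {n} {e f : Edge n} → e ≈ₑ f → f ≈ₑ e
≈ₑ-sym (inj₁ (refl , refl)) = inj₁ (refl , refl)
≈ₑ-sym (inj₂ (refl , refl)) = inj₂ (refl , refl)

≈ₑ-trans : ∀ {n} {e f g : Edge n} → e ≈ₑ f → f ≈ₑ g → e ≈ₑ g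
≈ₑ-trans (inj₁ (refl , refl)) q = q
≈ₑ-trans (inj₂ (refl , refl)) (inj₁ (refl , refl)) = inj₂ (refl , refl)
≈ₑ-trans (inj₂ (refl , refl)) (inj₂ (refl , refl)) = inj₁ (refl , refl)

≈ₑ-swap : ∀ {n} {u v : Fin n} → (u , v) ≈ₑ (v , u)
≈ₑ-swap = inj₂ (refl , refl)

mapEdge-≈ₑ : ∀ {k n} (f : Fin k → Fin n) {e e′ : Edge k} → e ≈ₑ e′ → mapEdge f e ≈ₑ mapEdge f e′
mapEdge-≈ₑ f (inj₁ (refl , refl)) = inj₁ (refl , refl)
mapEdge-≈ₑ f (inj₂ (refl , refl)) = inj₂ (refl , refl)

∈N⁺ : ∀ {n} (G : EOGraph n) {u v} → Adj G u v → v ∈ₛ N G u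
∈N⁺ G {u} {v} uv =
  Vecₚ.lookup⇒[]= v _ (trans (Vecₚ.lookup∘tabulate _ v) (dec-true (adj? G u v) uv))

∈N⁻ : ∀ {n} (G : EOGraph n) {u v} → v ∈ₛ N G u → Adj G u v
∈N⁻ G {u} {v} v∈N with adj? G u v | trans (sym (Vecₚ.lookup∘tabulate _ v)) (Vecₚ.[]=⇒lookup v∈N)
... | yes uv | _ = uv
... | no _   | ()

another-neighbour : ∀ {n} (G : EOGraph n) u v → 2 ≤ deg G u → ∃ λ w → w ≢ v × Adj G u w
another-neighbour G u v 2≤deg with Finₚ.any? (λ w → ¬? (w Fin.≟ v) ×-dec adj? G u w)
... | yes w = w
... | no ∄w = contradiction (ℕₚ.≤-trans 2≤deg deg≤1) (λ { (s≤s ()) })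
  where
  N⊆⁅v⁆ : ∀ {w} → w ∈ₛ N G u → w ∈ₛ ⁅ v ⁆
  N⊆⁅v⁆ {w} w∈N with w Fin.≟ v
  ... | yes refl = x∈⁅x⁆ w
  ... | no w≢v   = contradiction (w , w≢v , ∈N⁻ G w∈N) ∄w

  deg≤1 : deg G u ≤ 1
  deg≤1 = subst (deg G u ≤_) (∣⁅x⁆∣≡1 v) (p⊆q⇒∣p∣≤∣q∣ N⊆⁅v⁆)

-- The lower bound

-- Sending a vertex to the index of its occurrence is injective, because looking up that index
-- recovers the vertex.
covers⇒≤length : ∀ {n} {vs : List (Fin n)} → (∀ v → v ∈ vs) → n ≤ length vs
covers⇒≤length {vs = vs} cover = Finₚ.injective⇒≤ {f = λ v → Any.index (cover v)} λ {u} {v} eq →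
  trans (Anyₚ.lookup-index (cover u))
        (trans (cong (lookup vs) eq) (sym (Anyₚ.lookup-index (cover v))))

-- If some `w` is missing from `vs`, every other vertex is present, so `w ∷ vs` covers everything.
covers-all-but-one⇒≤length : ∀ {n} {vs : List (Fin n)} →
  (∀ {u v} → u ≢ v → u ∈ vs ⊎ v ∈ vs) → n ≤ suc (length vs)
covers-all-but-one⇒≤length {vs = vs} cover with Finₚ.any? (λ w → ¬? (any? (w Fin.≟_) vs))
... | no ∄w = ℕₚ.m≤n⇒m≤1+n (covers⇒≤length λ v →
  decidable-stable (any? (v Fin.≟_) vs) (λ v∉vs → ∄w (v , v∉vs)))
... | yes (w , w∉vs) = covers⇒≤length covered
  where
  covered : ∀ v → v ∈ w ∷ vs
  covered v with v Fin.≟ w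
  ... | yes v≡w = here v≡w
  ... | no v≢w  = Sum.[ there , (λ w∈vs → contradiction w∈vs w∉vs) ] (cover v≢w)

endpoints : ∀ {n} → List (Edge n) → List (Fin n)
endpoints []             = []
endpoints ((u , v) ∷ es) = u ∷ v ∷ endpoints es

length-endpoints : ∀ {n} (es : List (Edge n)) → length (endpoints es) ≡ length es * 2
length-endpoints []       = refl
length-endpoints (_ ∷ es) = cong (suc ∘ suc) (length-endpoints es)

∈-endpoints : ∀ {n} {u v : Fin n} {es} → Any ((u , v) ≈ₑ_) es → u ∈ endpoints es
∈-endpoints (here (inj₁ (refl , _))) = here refl
∈-endpoints (here (inj₂ (refl , _))) = there (here refl)
∈-endpoints (there uv)               = there (there (∈-endpoints uv))

sublist-lookup : ∀ {n} {es fs : List (Edge n)} {e} →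
  Sublist _≈ₑ_ es fs → Any (e ≈ₑ_) es → Any (e ≈ₑ_) fs
sublist-lookup (_ ∷ʳ τ) e∈es         = there (sublist-lookup τ e∈es)
sublist-lookup (r ∷ τ)  (here e≈)    = here (≈ₑ-trans e≈ r)
sublist-lookup (r ∷ τ)  (there e∈es) = there (sublist-lookup τ e∈es)

module _ {k} (G : EOGraph k) (a b : Fin k) (ab-min : IsMinimalEdge G a b) (2≤deg : 2 ≤ deg G a) where

  -- The added edge comes first, so it plays ab, and the further edge at a
  -- is found in H itself.
  added-edge-touches : ∀ {n} {H : EOGraph n} {u v} {u≢v : u ≢ v} {u≁v : ¬ Adj H u v} →
    (c : Copy G (addMin H u v u≢v u≁v)) → Uses c (u , v) →
    u ∈ endpoints (edges H) ⊎ v ∈ endpoints (edges H)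
  added-edge-touches {H = H} {u} {v} {u≁v = u≁v} c use
    with another-neighbour G a b 2≤deg
  ... | w , w≢b , aw = at G ab-min aw (orderly c) use
    where
    f : Fin k → _
    f = embed c

    -- Stated for a variable `G′` so that matching on the record exposes the first edge in all the
    -- hypotheses at once.
    at : ∀ (G′ : EOGraph k) → IsMinimalEdge G′ a b → Adj G′ a w →
      Sublist _≈ₑ_ (map (mapEdge f) (edges G′)) ((u , v) ∷ edges H) →
      Any ((u , v) ≈ₑ_) (map (mapEdge f) (edges G′)) →
      u ∈ endpoints (edges H) ⊎ v ∈ endpoints (edges H)
    -- If the copy skipped the added edge, it would lie in `H`, and then `H` would already contain
    -- `uv`.
    at record { edges = e ∷ es } (just ab≈e) aw (_ ∷ʳ τ) use =
      contradiction (sublist-lookup τ use) u≁v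
    -- The edge `aw` cannot be the first one: that is `ab`, so either `w ≡ b` or the edge is a loop.
    at record { edges = e ∷ es ; loopless = x≢y ∷ _ } (just ab≈e) (here aw≈e) (r ∷ τ) use
      with ≈ₑ-trans aw≈e (≈ₑ-sym ab≈e) | ab≈e
    ... | inj₁ (_ , w≡b)     | _                  = contradiction w≡b w≢b
    ... | inj₂ (refl , w≡a)  | inj₁ (refl , refl) = contradiction refl x≢y
    ... | inj₂ (refl , w≡a)  | inj₂ (refl , refl) = contradiction refl x≢y
    at record { edges = e ∷ es } (just ab≈e) (there aw) (r ∷ τ) use
      with ≈ₑ-trans (mapEdge-≈ₑ f ab≈e) r
         | ∈-endpoints (sublist-lookup τ (Anyₚ.map⁺ (Any.map (mapEdge-≈ₑ f) aw)))
    ... | inj₁ (fa≡u , _) | fa∈ = inj₁ (subst (_∈ _) fa≡u fa∈)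
    ... | inj₂ (fa≡v , _) | fa∈ = inj₂ (subst (_∈ _) fa≡v fa∈)

  saturated-size : ∀ {n} (H : EOGraph n) → Saturated G H → n ≤ suc (size H * 2)
  saturated-size {n} H sat =
    subst (λ m → n ≤ suc m) (length-endpoints (edges H)) (covers-all-but-one⇒≤length cover)
    where
    cover : ∀ {u v} → u ≢ v → u ∈ endpoints (edges H) ⊎ v ∈ endpoints (edges H)
    cover {u} {v} u≢v with adj? H u v
    ... | yes uv = inj₁ (∈-endpoints uv)
    ... | no u≁v = let c , use = sat u v u≢v u≁v in added-edge-touches c use

-- The upper bound

-- Here `es` stands for the edges of G after its minimal edge `ab`, so the adjacency `E` below is
-- that of G without `ab`.
module BlowUp {k} {a b : Fin k} (a≢b : a ≢ b) (es : List (Edge k))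
  (es-loopless : All (λ (x , y) → x ≢ y) es)
  (es-simple : AllPairs (λ e f → ¬ (e ≈ₑ f)) es)
  (ab∉es : All (λ e → ¬ ((a , b) ≈ₑ e)) es)
  (disjoint : ∀ c → Any ((a , c) ≈ₑ_) es → ¬ Any ((b , c) ≈ₑ_) es)
  {n} (k≤n : k ≤ n) where

  -- Edges and roles.

  E : Fin k → Fin k → Set
  E x y = Any ((x , y) ≈ₑ_) es

  E-sym : ∀ {x y} → E x y → E y x
  E-sym = Any.map (≈ₑ-trans ≈ₑ-swap)

  E-irrefl : ∀ {x y} → E x y → x ≢ y
  E-irrefl xy refl with All.lookupAny es-loopless xy
  ... | u≢v , inj₁ (x≡u , x≡v) = u≢v (trans (sym x≡u) x≡v)
  ... | u≢v , inj₂ (x≡v , x≡u) = u≢v (trans (sym x≡u) x≡v)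

  ¬Eab : ¬ E a b
  ¬Eab = Allₚ.All¬⇒¬Any ab∉es

  End : Fin k → Set
  End x = x ≡ a ⊎ x ≡ b

  end? : Decidable End
  end? x = x Fin.≟ a ⊎-dec x Fin.≟ b

  ends-not-adjacent : ∀ {x y} → End x → End y → ¬ E x y
  ends-not-adjacent (inj₁ refl) (inj₁ refl) xy = E-irrefl xy refl
  ends-not-adjacent (inj₁ refl) (inj₂ refl) xy = ¬Eab xy
  ends-not-adjacent (inj₂ refl) (inj₁ refl) xy = ¬Eab (E-sym xy)
  ends-not-adjacent (inj₂ refl) (inj₂ refl) xy = E-irrefl xy refl

  -- This is where the absence of common neighbours of `a` and `b` enters.
  one-end-per-neighbour : ∀ {x y z} → End x → End y → E x z → E y z → x ≡ y
  one-end-per-neighbour (inj₁ refl) (inj₁ refl) xz yz = refl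
  one-end-per-neighbour (inj₁ refl) (inj₂ refl) xz yz = contradiction yz (disjoint _ xz)
  one-end-per-neighbour (inj₂ refl) (inj₁ refl) xz yz = contradiction xz (disjoint _ yz)
  one-end-per-neighbour (inj₂ refl) (inj₂ refl) xz yz = refl

  -- The core consists of the vertices of Fin n below k; those that stand
  -- for a and b have no role, since every vertex outside the core plays
  -- both a and b.
  Role : Fin k → Fin n → Set
  Role x p = (End x × k ≤ toℕ p) ⊎ (¬ End x × toℕ p ≡ toℕ x)

  role? : ∀ x p → Dec (Role x p)
  role? x p = (end? x ×-dec k ℕₚ.≤? toℕ p) ⊎-dec (¬? (end? x) ×-dec toℕ p ℕₚ.≟ toℕ x)

  -- Whether `p` lies below `k` decides which alternative of `Role` applies, and a vertex below `k`
  -- determines its role by its value. Only `a` and `b` share their candidates.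
  role-unique : ∀ {x y p} → Role x p → Role y p → x ≡ y ⊎ (End x × End y)
  role-unique (inj₁ (ex , _)) (inj₁ (ey , _)) = inj₂ (ex , ey)
  role-unique {y = y} (inj₁ (_ , k≤p)) (inj₂ (_ , p≡y)) =
    contradiction (subst (_< k) (sym p≡y) (Finₚ.toℕ<n y)) (ℕₚ.≤⇒≯ k≤p)
  role-unique {x = x} (inj₂ (_ , p≡x)) (inj₁ (_ , k≤p)) =
    contradiction (subst (_< k) (sym p≡x) (Finₚ.toℕ<n x)) (ℕₚ.≤⇒≯ k≤p)
  role-unique (inj₂ (_ , p≡x)) (inj₂ (_ , p≡y)) =
    inj₁ (Finₚ.toℕ-injective (trans (sym p≡x) p≡y))

  Match : Edge k → Edge n → Set
  Match (x , y) (p , q) = (Role x p × Role y q) ⊎ (Role x q × Role y p)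

  match? : ∀ e f → Dec (Match e f)
  match? (x , y) (p , q) = (role? x p ×-dec role? y q) ⊎-dec (role? x q ×-dec role? y p)

  match-resp : ∀ {e f g} → f ≈ₑ g → Match e g → Match e f
  match-resp (inj₁ (refl , refl)) m = m
  match-resp (inj₂ (refl , refl)) m = Sum.swap m

  -- The role of an outer vertex is ambiguous between `a` and `b`, but its partner then has a fixed
  -- role, and that is adjacent to only one of them. Both vertices cannot be outer, since `E` does
  -- not join ends. Hence an edge has at most one rank.
  roles-unique : ∀ {x y x′ y′ p q} → E x y → E x′ y′ →
    Role x p → Role y q → Role x′ p → Role y′ q → (x , y) ≈ₑ (x′ , y′)
  roles-unique xy x′y′ xp yq x′p y′q with role-unique xp x′p | role-unique yq y′q
  ... | inj₁ refl       | inj₁ refl       = ≈ₑ-refl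
  ... | inj₁ refl       | inj₂ (ey , ey′) =
    inj₁ (refl , one-end-per-neighbour ey ey′ (E-sym xy) (E-sym x′y′))
  ... | inj₂ (ex , ex′) | inj₁ refl       = inj₁ (one-end-per-neighbour ex ex′ xy x′y′ , refl)
  ... | inj₂ (ex , _)   | inj₂ (ey , _)   = contradiction xy (ends-not-adjacent ex ey)

  match-unique : ∀ {x y x′ y′ f} → E x y → E x′ y′ →
    Match (x , y) f → Match (x′ , y′) f → (x , y) ≈ₑ (x′ , y′)
  match-unique xy x′y′ (inj₁ (xp , yq)) (inj₁ (x′p , y′q)) = roles-unique xy x′y′ xp yq x′p y′q
  match-unique xy x′y′ (inj₁ (xp , yq)) (inj₂ (x′q , y′p)) =
    ≈ₑ-trans (roles-unique xy (E-sym x′y′) xp yq y′p x′q) ≈ₑ-swap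
  match-unique xy x′y′ (inj₂ (xq , yp)) (inj₁ (x′p , y′q)) =
    ≈ₑ-trans (roles-unique xy (E-sym x′y′) xq yp y′q x′p) ≈ₑ-swap
  match-unique xy x′y′ (inj₂ (xq , yp)) (inj₂ (x′q , y′p)) = roles-unique xy x′y′ xq yp x′q y′p

  -- The pairs that meet the core.

  core : Fin k → Fin n
  core x = inject≤ x k≤n

  toℕ-core : ∀ x → toℕ (core x) ≡ toℕ x
  toℕ-core x = Finₚ.toℕ-inject≤ x k≤n

  core<k : ∀ x → toℕ (core x) < k
  core<k x = subst (_< k) (sym (toℕ-core x)) (Finₚ.toℕ<n x)

  cores : List (Fin n)
  cores = map core (allFin k)

  increasing? : Decidable (λ ((p , q) : Edge n) → p Fin.< q)
  increasing? (p , q) = p Fin.<? q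

  core×all : List (Edge n)
  core×all = cartesianProduct cores (allFin n)

  -- The core is an initial segment of `Fin n`, so a pair that meets it has its smaller vertex
  -- there. Keeping only increasing pairs therefore lists each such pair exactly once.
  corePairs : List (Edge n)
  corePairs = filter increasing? core×all

  corePairs-increasing : All (λ (p , q) → p Fin.< q) corePairs
  corePairs-increasing = Allₚ.all-filter increasing? core×all

  corePairs-simple : AllPairs (λ e f → ¬ (e ≈ₑ f)) corePairs
  corePairs-simple = distinct corePairs-increasing
    (Uniqueₚ.filter⁺ increasing?
      (Uniqueₚ.cartesianProduct⁺
        (Uniqueₚ.map⁺ (Finₚ.inject≤-injective k≤n k≤n _ _) (Uniqueₚ.allFin⁺ k))
        (Uniqueₚ.allFin⁺ n)))
    where
    distinct : ∀ {fs} → All (λ (p , q) → p Fin.< q) fs → Unique fs →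
      AllPairs (λ e f → ¬ (e ≈ₑ f)) fs
    distinct []          []         = []
    distinct (p<q ∷ <s) (e≢ ∷ ≢s) =
      All.zipWith (λ { (_   , e≢f) (inj₁ (refl , refl)) → e≢f refl
                     ; (q<p , _)   (inj₂ (refl , refl)) → ℕₚ.<-asym p<q q<p })
                  (<s , e≢)
      ∷ distinct <s ≢s

  ∈-corePairs : ∀ {p q} → p Fin.< q → toℕ p < k → (p , q) ∈ corePairs
  ∈-corePairs {p} {q} p<q p<k =
    ∈ₚ.∈-filter⁺ increasing? (∈ₚ.∈-cartesianProduct⁺ p∈cores (∈ₚ.∈-allFin q)) p<q
    where
    p∈cores : p ∈ cores
    p∈cores = subst (_∈ cores)
      (Finₚ.toℕ-injective (trans (toℕ-core (fromℕ< p<k)) (Finₚ.toℕ-fromℕ< p<k)))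
      (∈ₚ.∈-map⁺ core (∈ₚ.∈-allFin (fromℕ< p<k)))

  length-corePairs : length corePairs ≤ k * n
  length-corePairs = ℕₚ.≤-trans (length-filter increasing? core×all)
    (ℕₚ.≤-reflexive (trans (length-× cores)
      (cong₂ _*_
        (trans (length-map core (allFin k)) (length-tabulate {n = k} _)) (length-tabulate {n = n} _))))
    where
    length-× : ∀ ps → length (cartesianProduct ps (allFin n)) ≡ length ps * length (allFin n)
    length-× []       = refl
    length-× (p ∷ ps) = trans (length-++ (map (p ,_) (allFin n)))
      (cong₂ _+_ (length-map (p ,_) (allFin n)) (length-× ps))

  -- The blow-up graph.

  block : Edge k → List (Edge n)
  block e = filter (match? e) corePairs

  unmatched? : Decidable (λ f → ¬ Any (λ e → Match e f) es)
  unmatched? f = ¬? (any? (λ e → match? e f) es)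

  unmatched : List (Edge n)
  unmatched = filter unmatched? corePairs

  -- Each block inherits simplicity from `corePairs`. An edge common to two blocks would match two
  -- different edges of `es`, against `match-unique`.
  blocks-simple : AllPairs (λ e f → ¬ (e ≈ₑ f)) (concatMap block es)
  blocks-simple = AllPairsₚ.concat⁺
    (Allₚ.map⁺ (All.universal (λ e → AllPairsₚ.filter⁺ (match? e) corePairs-simple) es))
    (AllPairsₚ.map⁺ (apart (All.tabulate λ e∈es → Any.map (λ { refl → ≈ₑ-refl }) e∈es) es-simple))
    where
    apart : ∀ {fs} → All (λ (x , y) → E x y) fs → AllPairs (λ e f → ¬ (e ≈ₑ f)) fs →
      AllPairs (λ e f → All (λ p → All (λ q → ¬ (p ≈ₑ q)) (block f)) (block e)) fs
    apart []          []         = []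
    apart (xy ∷ xys) (e≉ ∷ ≉s) =
      All.zipWith (λ (x′y′ , e≉f) →
        All.map (λ mp → All.map (λ mq p≈q → e≉f (match-unique xy x′y′ mp (match-resp p≈q mq)))
                                (Allₚ.all-filter (match? _) corePairs))
                (Allₚ.all-filter (match? _) corePairs))
        (xys , e≉)
      ∷ apart xys ≉s

  -- The blocks follow the order of `es`, which gives every matched edge the rank of the edge it
  -- plays. The unmatched pairs are kept, after all blocks, so that no missing edge meets the core.
  blowUp : EOGraph n
  blowUp = record
    { edges    = concatMap block es ++ unmatched
    ; loopless = All.map Finₚ.<⇒≢ (Allₚ.++⁺
        (Allₚ.concat⁺ (Allₚ.map⁺
          (All.universal (λ e → Allₚ.filter⁺ (match? e) corePairs-increasing) es)))
        (Allₚ.filter⁺ unmatched? corePairs-increasing))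
    ; simple   = AllPairsₚ.++⁺ blocks-simple (AllPairsₚ.filter⁺ unmatched? corePairs-simple)
        (Allₚ.concat⁺ (Allₚ.map⁺ (All.tabulate λ e∈es →
          All.map (λ mp → All.map (λ ¬mq p≈q → ¬mq (lose e∈es (match-resp (≈ₑ-sym p≈q) mp)))
                                  (Allₚ.all-filter unmatched? corePairs))
                  (Allₚ.all-filter (match? _) corePairs))))
    }

  -- Every block, and also `unmatched`, is a filtering of `corePairs` and so has at most `k * n`
  -- edges. There are `length es` blocks.
  size-blowUp : size blowUp ≤ suc (length es) * k * n
  size-blowUp = subst (size blowUp ≤_) (sym (ℕₚ.*-assoc (suc (length es)) k n)) (begin
    size blowUp                ≡⟨ length-++ (concatMap block es) ⟩
    length (concatMap block es) + length unmatched
      ≤⟨ ℕₚ.+-mono-≤ (blocks≤ es) (filtered≤ unmatched?) ⟩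
    length es * (k * n) + k * n    ≡⟨ ℕₚ.+-comm _ (k * n) ⟩
    suc (length es) * (k * n)  ∎)
    where
    open ℕₚ.≤-Reasoning

    filtered≤ : ∀ {P : Edge n → Set} (P? : Decidable P) → length (filter P? corePairs) ≤ k * n
    filtered≤ P? = ℕₚ.≤-trans (length-filter P? corePairs) length-corePairs

    blocks≤ : ∀ fs → length (concatMap block fs) ≤ length fs * (k * n)
    blocks≤ []       = z≤n
    blocks≤ (e ∷ fs) = subst (_≤ suc (length fs) * (k * n)) (sym (length-++ (block e)))
      (ℕₚ.+-mono-≤ (filtered≤ (match? e)) (blocks≤ fs))

  core-adj : ∀ {p q} → p Fin.< q → toℕ p < k → Adj blowUp p q
  core-adj {p} {q} p<q p<k = Any.map (λ { refl → ≈ₑ-refl }) pq∈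
    where
    pq∈ : (p , q) ∈ edges blowUp
    pq∈ with any? (λ e → match? e (p , q)) es
    ... | yes m = ∈ₚ.∈-++⁺ˡ (∈ₚ.∈-concatMap⁺ block
                    (Any.map (∈ₚ.∈-filter⁺ (match? _) (∈-corePairs p<q p<k)) m))
    ... | no ¬m = ∈ₚ.∈-++⁺ʳ _ (∈ₚ.∈-filter⁺ unmatched? (∈-corePairs p<q p<k) ¬m)

  -- It suffices to bound the smaller vertex: if it were in the core, `core-adj` would supply the
  -- edge.
  nonadjacent-outside : ∀ {u v} → u ≢ v → ¬ Adj blowUp u v → k ≤ toℕ u × k ≤ toℕ v
  nonadjacent-outside {u} {v} u≢v u≁v with Finₚ.<-cmp u v
  ... | tri≈ _ u≡v _ = contradiction u≡v u≢v
  ... | tri< u<v _ _ = let k≤u = ℕₚ.≮⇒≥ (u≁v ∘ core-adj u<v) in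
    k≤u , ℕₚ.≤-trans k≤u (ℕₚ.<⇒≤ u<v)
  ... | tri> _ _ v<u = let k≤v = ℕₚ.≮⇒≥ (u≁v ∘ Any.map (≈ₑ-trans ≈ₑ-swap) ∘ core-adj v<u) in
    ℕₚ.≤-trans k≤v (ℕₚ.<⇒≤ v<u) , k≤v

  -- The copy of G through a missing edge.

  module _ {u v : Fin n} (u≢v : u ≢ v) (k≤u : k ≤ toℕ u) (k≤v : k ≤ toℕ v) where

    place : Fin k → Fin n
    place x with x Fin.≟ a | x Fin.≟ b
    ... | yes _ | _     = u
    ... | no _  | yes _ = v
    ... | no _  | no _  = core x

    place-a : place a ≡ u
    place-a with a Fin.≟ a
    ... | yes _  = refl
    ... | no a≢a = contradiction refl a≢a

    place-b : place b ≡ v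
    place-b with b Fin.≟ a | b Fin.≟ b
    ... | yes b≡a | _      = contradiction (sym b≡a) a≢b
    ... | no _    | yes _  = refl
    ... | no _    | no b≢b = contradiction refl b≢b

    place-role : ∀ x → Role x (place x)
    place-role x with x Fin.≟ a | x Fin.≟ b
    ... | yes x≡a | _       = inj₁ (inj₁ x≡a , k≤u)
    ... | no _    | yes x≡b = inj₁ (inj₂ x≡b , k≤v)
    ... | no x≢a  | no x≢b  = inj₂ (Sum.[ x≢a , x≢b ] , toℕ-core x)

    -- Vertices with a common image share a role, so they are equal or both are ends; distinct ends
    -- go to the distinct vertices `u` and `v`.
    place-injective : ∀ {x y} → place x ≡ place y → x ≡ y
    place-injective {x} {y} eq
      with role-unique (place-role x) (subst (Role y) (sym eq) (place-role y))
    ... | inj₁ x≡y                       = x≡y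
    ... | inj₂ (inj₁ refl , inj₁ refl)   = refl
    ... | inj₂ (inj₂ refl , inj₂ refl)   = refl
    ... | inj₂ (inj₁ refl , inj₂ refl)   =
      contradiction (trans (sym place-a) (trans eq place-b)) u≢v
    ... | inj₂ (inj₂ refl , inj₁ refl)   =
      contradiction (trans (sym place-a) (trans (sym eq) place-b)) u≢v

    -- Ends are not adjacent, so one of the two images is in the core, and then the smaller image is
    -- too.
    place-< : ∀ {x y} → E x y → place x Fin.< place y → toℕ (place x) < k
    place-< {x} {y} xy x<y with place-role x | place-role y
    ... | inj₂ (_ , x≡)    | _                = subst (_< k) (sym x≡) (Finₚ.toℕ<n x)
    ... | inj₁ (ex , _)    | inj₁ (ey , _)    = contradiction xy (ends-not-adjacent ex ey)
    ... | inj₁ (_ , k≤x)   | inj₂ (_ , y≡)    =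
      contradiction (ℕₚ.<-trans x<y (subst (_< k) (sym y≡) (Finₚ.toℕ<n y))) (ℕₚ.≤⇒≯ k≤x)

    place-in-block : ∀ {x y} → E x y → Any (mapEdge place (x , y) ≈ₑ_) (block (x , y))
    place-in-block {x} {y} xy with Finₚ.<-cmp (place x) (place y)
    ... | tri≈ _ eq _  = contradiction (place-injective eq) (E-irrefl xy)
    ... | tri< x<y _ _ = lose
      (∈ₚ.∈-filter⁺ (match? _) (∈-corePairs x<y (place-< xy x<y))
                    (inj₁ (place-role x , place-role y)))
      ≈ₑ-refl
    ... | tri> _ _ y<x = lose
      (∈ₚ.∈-filter⁺ (match? _) (∈-corePairs y<x (place-< (E-sym xy) y<x))
                    (inj₂ (place-role x , place-role y)))
      ≈ₑ-swap

    -- Picking the image of each edge from its own block respects the order, because the blocks are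
    -- concatenated in the order of `es`.
    place-orderly : Sublist _≈ₑ_ (map (mapEdge place) es) (edges blowUp)
    place-orderly = Sublistₚ.++ʳ unmatched
      (choose (All.tabulate λ e∈es → place-in-block (Any.map (λ { refl → ≈ₑ-refl }) e∈es)))
      where
      choose : ∀ {fs} → All (λ e → Any (mapEdge place e ≈ₑ_) (block e)) fs →
        Sublist _≈ₑ_ (map (mapEdge place) fs) (concatMap block fs)
      choose []       = []
      choose (i ∷ is) = Sublistₚ.++⁺ (fromAny i) (choose is)

few-edges-saturated : ∀ {k} (G : EOGraph k) (a b : Fin k) →
  IsMinimalEdge G a b → Empty (N G a ∩ N G b) → ∀ {n} → k ≤ n →
  ∃ λ (H : EOGraph n) → Saturated G H × size H ≤ size G * k * n
few-edges-saturated {k}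
  G@record { edges    = e ∷ es
           ; loopless = e-loopless ∷ es-loopless
           ; simple   = e∉es ∷ es-simple }
  a b (just ab≈e) disjoint {n} k≤n = blowUp , saturated , size-blowUp
  where
  a≢b : a ≢ b
  a≢b a≡b = Sum.[ (λ (a≡x , b≡y) → e-loopless (trans (sym a≡x) (trans a≡b b≡y)))
                , (λ (a≡y , b≡x) → e-loopless (trans (sym b≡x) (trans (sym a≡b) a≡y))) ] ab≈e

  open BlowUp a≢b es es-loopless es-simple
    (All.map (λ e≉f ab≈f → e≉f (≈ₑ-trans (≈ₑ-sym ab≈e) ab≈f)) e∉es)
    (λ c ac bc → disjoint (c , x∈p∩q⁺ (∈N⁺ G (there ac) , ∈N⁺ G (there bc)))) k≤n

  saturated : Saturated G blowUp
  saturated u v u≢v u≁v = record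
    { embed     = f
    ; injective = place-injective u≢v k≤u k≤v
    -- The minimal edge of G goes to the added edge, which is first; the remaining edges go into the
    -- blow-up.
    ; orderly   = ≈ₑ-sym uv≈fe ∷ place-orderly u≢v k≤u k≤v
    } , here uv≈fe
    where
    k≤u = proj₁ (nonadjacent-outside u≢v u≁v)
    k≤v = proj₂ (nonadjacent-outside u≢v u≁v)
    f = place u≢v k≤u k≤v

    uv≈fe : (u , v) ≈ₑ mapEdge f e
    uv≈fe = ≈ₑ-trans (inj₁ (sym (place-a u≢v k≤u k≤v) , sym (place-b u≢v k≤u k≤v)))
                     (mapEdge-≈ₑ f ab≈e)

claim27 : ∀ {k : ℕ} (G : EOGraph k) (a b : Fin k) →
    IsMinimalEdge G a b → 2 ≤ deg G a → Empty (N G a ∩ N G b) →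
    (λ n → ssatₘ n G) =Θ (λ n → n)
-- The threshold `2 + k` serves both bounds: the lower one needs `2 ≤ n`, and the core of the upper
-- one needs `k ≤ n`.
claim27 {k} G a b ab-min 2≤deg disjoint = 3 , size G * k , 2 + k , λ n 2+k≤n →
  lower (ℕₚ.≤-trans (ℕₚ.m≤m+n 2 k) 2+k≤n) , upper (ℕₚ.≤-trans (ℕₚ.m≤n+m k 2) 2+k≤n)
  where
  -- As `2 ≤ n` forces `s` to be positive, the extra 1 is absorbed into a third `s`.
  n≤1+2s⇒n≤3s : ∀ {n} s → 2 ≤ n → n ≤ suc (s * 2) → n ≤ 3 * s
  n≤1+2s⇒n≤3s zero    2≤n n≤1 = contradiction (ℕₚ.≤-trans 2≤n n≤1) (λ { (s≤s ()) })
  n≤1+2s⇒n≤3s {n} (suc s) 2≤n n≤  = ℕₚ.≤-trans n≤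
    (subst (suc (suc s * 2) ≤_) (trans (sym (ℕₚ.*-suc (suc s) 2)) (ℕₚ.*-comm (suc s) 3))
      (ℕₚ.+-monoˡ-≤ (suc s * 2) (s≤s z≤n)))

  lower : ∀ {n} → 2 ≤ n → n ≤ 3 * ssatₘ n G
  lower {n} 2≤n with ssatₘ n G | proj₁ (ssatₘ-isLeast n G)
  ... | s | H , sat , refl = n≤1+2s⇒n≤3s s 2≤n (saturated-size G a b ab-min 2≤deg H sat)

  upper : ∀ {n} → k ≤ n → ssatₘ n G ≤ size G * k * n
  upper {n} k≤n = let H , sat , size≤ = few-edges-saturated G a b ab-min disjoint k≤n in
    ℕₚ.≤-trans (proj₂ (ssatₘ-isLeast n G) (size H) (H , sat , refl)) size≤
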